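{- Let $$F(x,y) = a_4 x^4 + a_3 x^3 y + a_2 x^2 y^2 + a_1 x y^3 + a_0 y^4$$ be a binary quartic form defined over a field $K$, and let $(A_0, B_F)$ be the pair of symmetric matrices $$A_0 = \begin{bmatrix} 0 & 0 & 1/2 \\ 0 & -1 & 0 \\ 1/2 & 0 & 0 \end{bmatrix}, \qquad B_F = \begin{bmatrix} a_4 & a_3/2 & 0 \\ a_3/2 & a_2 & a_1/2 \\ 0 & a_1/2 & a_0 \end{bmatrix}.$$ Let $F_4$ be the Hessian covariant of $F$. Then $$F_4(x,y) = 6\, g_{B_F}(x^2, xy, y^2) + 3\, g_{A_0}(x^2, xy, y^2).$$
   Context: The Hessian covariant of a binary quartic form $F(x,y)$ is the (unnormalized) Hessian determinant $$F_4(x,y) = \frac{\partial^2 F}{\partial x^2}\frac{\partial^2 F}{\partial y^2} - \left(\frac{\partial^2 F}{\partial x\,\partial y}\right)^2.$$ For a square matrix $M$, $M^\dagger$ denotes the adjugate matrix of $M$. For a pair $(A,B)$ of symmetric $3\times 3$ matrices put $$g_B(\mathbf{x}) = \mathbf{x}^t (A B^\dagger A)\mathbf{x}, \qquad g_A(\mathbf{x}) = \mathbf{x}^t (B A^\dagger B)\mathbf{x}.$$ The forms $g_{B_F}$ and $g_{A_0}$ are these quadratic forms for the pair $(A,B) = (A_0, B_F)$.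
   Formalization: The printed identity is off by a factor 16 (for F = x²y², F_4 = -12x²y² but the right side is -¾x²y²); what is proved is F_4 = 16(6 g_{B_F} + 3 g_{A_0}), over any field K of characteristic not 2, as needed for the entries 1/2. -}

module Defs where

open import Algebra.Apartness.Bundles using (HeytingField)
open import Algebra.Bundles using (CommutativeRing)
open import Algebra.Bundles.Raw using (RawRing)
import Algebra.Definitions.RawSemiring as RawSemiringDefinitions
open import Data.Fin.Base using (Fin; zero; suc; toℕ; punchIn)
open import Data.List.Base using (List; []; _∷_; map)
open import Data.Nat.Base as ℕ using (ℕ; zero; suc)
open import Data.Product.Base using (proj₁)
import Data.Vec.Functional as Vector
open Vector using (Vector)

-- Univariate polynomials as coefficient lists, constant term first.  Trailing
-- zeros are allowed, so equality compares coefficients instead of lists.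
module Polynomial {c ℓ} (R : RawRing c ℓ) where
  open RawRing R
  open RawSemiringDefinitions rawSemiring using (_×_)

  coeff : List Carrier → ℕ → Carrier
  coeff []      n       = 0#
  coeff (a ∷ p) zero    = a
  coeff (a ∷ p) (suc n) = coeff p n

  add : List Carrier → List Carrier → List Carrier
  add []      q       = q
  add (a ∷ p) []      = a ∷ p
  add (a ∷ p) (b ∷ q) = (a + b) ∷ add p q

  mul : List Carrier → List Carrier → List Carrier
  mul []      q = []
  mul (a ∷ p) q = add (map (a *_) q) (0# ∷ mul p q)

  polynomialRing : RawRing c ℓ
  polynomialRing = record
    { Carrier = List Carrier
    ; _≈_     = λ p q → ∀ n → coeff p n ≈ coeff q n
    ; _+_     = add
    ; _*_     = mul
    ; -_      = map (-_)
    ; 0#      = []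
    ; 1#      = 1# ∷ []
    }

  const : Carrier → List Carrier
  const a = a ∷ []

  indeterminate : List Carrier
  indeterminate = 0# ∷ 1# ∷ []

  derivative : List Carrier → List Carrier
  derivative []      = []
  derivative (_ ∷ p) = weighted 1 p
    where
    weighted : ℕ → List Carrier → List Carrier
    weighted k []      = []
    weighted k (a ∷ p) = (k × a) ∷ weighted (suc k) p

-- R[x,y] is built as (R[x])[y].
module BivariatePolynomial {c ℓ} (R : RawRing c ℓ) where
  module Inner = Polynomial R
  module Outer = Polynomial Inner.polynomialRing

  R[x,y] : RawRing c ℓ
  R[x,y] = Outer.polynomialRing

  open RawRing R[x,y] public
  open RawSemiringDefinitions rawSemiring public using (_×_; _^_; sum)

  const : RawRing.Carrier R → Carrier
  const a = Outer.const (Inner.const a)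

  x y : Carrier
  x = Outer.const Inner.indeterminate
  y = Outer.indeterminate

  ∂x ∂y : Carrier → Carrier
  ∂x = map Inner.derivative
  ∂y = Outer.derivative

  hessian : Carrier → Carrier
  hessian f = ∂x (∂x f) * ∂y (∂y f) + (- (∂x (∂y f) ^ 2))

module Matrices {c ℓ} (R : RawRing c ℓ) where
  open RawRing R
  open RawSemiringDefinitions rawSemiring using (_^_; sum)

  Matrix : ℕ → ℕ → Set c
  Matrix m n = Fin m → Fin n → Carrier

  infixl 7 _*ᴹ_
  _*ᴹ_ : ∀ {l m n} → Matrix l m → Matrix m n → Matrix l n
  (M *ᴹ N) i k = sum λ j → M i j * N j k

  minor : ∀ {n} → Matrix (suc n) (suc n) → Fin (suc n) → Fin (suc n) → Matrix n n
  minor M i j k l = M (punchIn i k) (punchIn j l)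

  sign : ℕ → Carrier
  sign k = (- 1#) ^ k

  det : ∀ {n} → Matrix n n → Carrier
  det {zero}  M = 1#
  det {suc n} M = sum λ j → sign (toℕ j) * M zero j * det (minor M zero j)

  infix 9 _†
  _† : ∀ {n} → Matrix n n → Matrix n n
  _† {zero}  M ()
  _† {suc n} M i j = sign (toℕ i ℕ.+ toℕ j) * det (minor M j i)

Char≠2 : ∀ {c ℓ₁ ℓ₂} → HeytingField c ℓ₁ ℓ₂ → Set ℓ₂
Char≠2 K = (1# + 1#) # 0#
  where open HeytingField K

module QuarticForms {c ℓ₁ ℓ₂} (K : HeytingField c ℓ₁ ℓ₂) (2#0 : Char≠2 K) where

  private module K = HeytingField K
  open K using () renaming (Carrier to ∣K∣)

  rawRing : RawRing c ℓ₁
  rawRing = CommutativeRing.rawRing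
    (record { isCommutativeRing = K.isCommutativeRing })

  open Matrices rawRing public
  open BivariatePolynomial rawRing public

  -- The library's invertibility is about the difference (1 + 1) - 0.
  ½ : ∣K∣
  ½ = proj₁ (K.#⇒invertible 2#0)

  -- 𝐱ᵗ M 𝐱 for a matrix M over K, with 𝐱 taken in K[x,y]³.
  quadraticForm : ∀ {n} → Matrix n n → Vector Carrier n → Carrier
  quadraticForm M 𝐱 = sum λ i → sum λ j → 𝐱 i * const (M i j) * 𝐱 j

  -- g-B A B and g-A A B are the forms g_B and g_A of the pair (A , B).  They are
  -- homogeneous of degree 2 in A and in B.  With the unnormalised Hessian and
  -- the matrices A₀, B-F below, F₄ = 6 g_B + 3 g_A fails over ℚ: F = x²y² has
  -- F₄ = -12 x²y², g_B = 0 and g_A = -¼ x²y².  The missing factor is 16, as if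
  -- the forms were taken for the pair (2A , 2B).
  g-B g-A : Matrix 3 3 → Matrix 3 3 → Vector Carrier 3 → Carrier
  g-B A B = quadraticForm (A *ᴹ B † *ᴹ A)
  g-A A B = quadraticForm (B *ᴹ A † *ᴹ B)

  quartic : (a₄ a₃ a₂ a₁ a₀ : ∣K∣) → Carrier
  quartic a₄ a₃ a₂ a₁ a₀ =
      const a₄ * x ^ 4
    + const a₃ * x ^ 3 * y
    + const a₂ * x ^ 2 * y ^ 2
    + const a₁ * x * y ^ 3
    + const a₀ * y ^ 4

  matrix₃ : (a b c d e f g h i : ∣K∣) → Matrix 3 3
  matrix₃ a b c d e f g h i = row₁ Vector.∷ row₂ Vector.∷ row₃ Vector.∷ Vector.[]
    where
    row₁ row₂ row₃ : Vector ∣K∣ 3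
    row₁ = a Vector.∷ b Vector.∷ c Vector.∷ Vector.[]
    row₂ = d Vector.∷ e Vector.∷ f Vector.∷ Vector.[]
    row₃ = g Vector.∷ h Vector.∷ i Vector.∷ Vector.[]

  A₀ : Matrix 3 3
  A₀ = matrix₃
    K.0#   K.0#        ½
    K.0#   (K.- K.1#)  K.0#
    ½      K.0#        K.0#

  B-F : (a₄ a₃ a₂ a₁ a₀ : ∣K∣) → Matrix 3 3
  B-F a₄ a₃ a₂ a₁ a₀ = matrix₃
    a₄          (a₃ K.* ½)  K.0#
    (a₃ K.* ½)  a₂          (a₁ K.* ½)
    K.0#        (a₁ K.* ½)  a₀

  monomials : Vector Carrier 3
  monomials = x ^ 2 Vector.∷ x * y Vector.∷ y ^ 2 Vector.∷ Vector.[]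

{-# OPTIONS --safe #-}
module Submission where

open import Defs
open import Algebra.Apartness.Bundles using (HeytingField; HeytingCommutativeRing)
open import Algebra.Bundles using (CommutativeRing)
open import Algebra.Bundles.Raw using (RawRing)
import Algebra.Definitions.RawSemiring as RawSemiringDefinitions
import Algebra.Morphism.Construct.Composition as Composition
open import Algebra.Morphism.Structures using (IsRingHomomorphism)
import Algebra.Solver.Ring
open import Algebra.Solver.Ring.AlmostCommutativeRing
  using (fromCommutativeRing; _-Raw-AlmostCommutative⟶_)
open import Algebra.Structures using (IsCommutativeRing)
open import Data.Fin.Base using (Fin)
open import Data.Fin.Patterns
open import Data.Integer.Base as ℤ using (ℤ; +_; -[1+_]; _⊖_)
import Data.Integer.Properties as ℤ
open import Data.List.Base using (List; []; _∷_; map)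
import Data.Maybe.Base as Maybe
open import Data.Nat.Base as ℕ using (ℕ; zero; suc)
import Data.Nat.Properties as ℕ
open import Data.Product.Base using (_,_; proj₁; proj₂)
open import Data.Vec.Base using (Vec; []; _∷_; lookup)
import Data.Vec.Functional as Vector
open Vector using (Vector)
open import Level using (_⊔_; 0ℓ)
open import Relation.Binary.PropositionalEquality.Core as ≡ using (_≡_)
open import Relation.Nullary.Decidable.Core using (dec⇒maybe)

-- Writing 1 = 2h with h = ½, every entry of A₀ and of B_F becomes h times a
-- polynomial with integer coefficients (for instance a₄ = h · 2a₄).  Hence the
-- forms g_B and g_A, which have total degree 4 in the two matrices, are h⁴ U and
-- h⁴ V with U and V integral, and 16 h⁴ = 1.  What remains is the polynomial
-- identity F₄ = 6 U + 3 V over ℤ.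

-- A ring solver treats `h` as a free variable and cannot use the relation `h + h = 1`. Making every
-- matrix entry a multiple of `h` confines that relation to rewriting single entries and to
-- cancelling one scalar factor; all other steps hold for free variables. The Hessian is the second
-- obstacle, being defined by derivatives of nested coefficient lists. It is not expanded there. The
-- two partial derivatives enter only as derivations with known values on constants, `x` and `y`.
-- These values determine them on the value of every ring term, so the Hessian of the quartic is the
-- value of a term obtained by formal differentiation, and that term can be handed to the solver.

record IsDerivation {c ℓ} (R : CommutativeRing c ℓ)
                    (D : CommutativeRing.Carrier R → CommutativeRing.Carrier R) : Set (c ⊔ ℓ) where
  open CommutativeRing R
  field
    D-cong  : ∀ {x y} → x ≈ y → D x ≈ D y
    D-+     : ∀ x y → D (x + y) ≈ D x + D y
    leibniz : ∀ x y → D (x * y) ≈ D x * y + x * D y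

  open import Algebra.Properties.Ring ring
    using (x+x≈x⇒x≈0; +-inverseʳ-unique)
  open import Relation.Binary.Reasoning.Setoid setoid

  D-0# : D 0# ≈ 0#
  D-0# = x+x≈x⇒x≈0 (D 0#) (trans (sym (D-+ 0# 0#)) (D-cong (+-identityˡ 0#)))

  D-1# : D 1# ≈ 0#
  D-1# = x+x≈x⇒x≈0 (D 1#) (begin
    D 1# + D 1#            ≈⟨ +-cong (*-identityʳ _) (*-identityˡ _) ⟨
    D 1# * 1# + 1# * D 1#  ≈⟨ leibniz 1# 1# ⟨
    D (1# * 1#)            ≈⟨ D-cong (*-identityˡ 1#) ⟩
    D 1#                   ∎)

  D-neg : ∀ x → D (- x) ≈ - D x
  D-neg x = +-inverseʳ-unique (D x) (D (- x)) (begin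
    D x + D (- x)  ≈⟨ D-+ x (- x) ⟨
    D (x + - x)    ≈⟨ D-cong (-‿inverseʳ x) ⟩
    D 0#           ≈⟨ D-0# ⟩
    0#             ∎)

-- Coefficient lists form a commutative ring.

module PolynomialRing {c ℓ} (R : CommutativeRing c ℓ) where
  open CommutativeRing R
  open Polynomial rawRing
  open RawRing polynomialRing using () renaming (_≈_ to _≋_)
  open import Algebra.Properties.CommutativeMonoid.Mult +-commutativeMonoid
    using (_×_; ×-congˡ; ×-congʳ; ×-distrib-+)
  open import Algebra.Properties.CommutativeSemigroup +-commutativeSemigroup
    using () renaming (interchange to +-interchange; x∙yz≈y∙xz to x+yz≈y+xz)
  open import Algebra.Properties.Semiring.Mult semiring using (×-comm-*)
  open import Algebra.Properties.Ring ring using (-0#≈0#)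
  open import Relation.Binary.Reasoning.Setoid setoid

  coeff-add : ∀ p q n → coeff (add p q) n ≈ coeff p n + coeff q n
  coeff-add []      q       n       = sym (+-identityˡ _)
  coeff-add (a ∷ p) []      n       = sym (+-identityʳ _)
  coeff-add (a ∷ p) (b ∷ q) zero    = refl
  coeff-add (a ∷ p) (b ∷ q) (suc n) = coeff-add p q n

  -- Beyond the end of the list every coefficient is `0#` and out of reach of `map`, hence the
  -- condition that `f` fixes zero.
  coeff-map : ∀ f → 0# ≈ f 0# → ∀ p n → coeff (map f p) n ≈ f (coeff p n)
  coeff-map f f0 []      n       = f0
  coeff-map f f0 (a ∷ p) zero    = refl
  coeff-map f f0 (a ∷ p) (suc n) = coeff-map f f0 p n

  coeff-scale : ∀ a p n → coeff (map (a *_) p) n ≈ a * coeff p n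
  coeff-scale a = coeff-map (a *_) (sym (zeroʳ a))

  coeff-neg : ∀ p n → coeff (map (-_) p) n ≈ - coeff p n
  coeff-neg = coeff-map (-_) (sym -0#≈0#)

  -- Prepending `0#` is multiplication by the indeterminate. The `shift` lemmas carry induction
  -- hypotheses through it.
  shift-cong : ∀ p q → p ≋ q → (0# ∷ p) ≋ (0# ∷ q)
  shift-cong p q p≋q zero    = refl
  shift-cong p q p≋q (suc n) = p≋q n

  shift-add : ∀ p q n → coeff (0# ∷ add p q) n ≈ coeff (0# ∷ p) n + coeff (0# ∷ q) n
  shift-add p q zero    = sym (+-identityˡ 0#)
  shift-add p q (suc n) = coeff-add p q n

  shift-scale : ∀ a p n → coeff (0# ∷ map (a *_) p) n ≈ a * coeff (0# ∷ p) n
  shift-scale a p zero    = sym (zeroʳ a)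
  shift-scale a p (suc n) = coeff-scale a p n

  mul-∷ˡ : ∀ a p q n → coeff (mul (a ∷ p) q) n ≈ a * coeff q n + coeff (0# ∷ mul p q) n
  mul-∷ˡ a p q n = trans (coeff-add (map (a *_) q) _ n) (+-congʳ (coeff-scale a q n))

  mul-zeroʳ : ∀ p n → coeff (mul p []) n ≈ 0#
  mul-zeroʳ []      n       = refl
  mul-zeroʳ (a ∷ p) zero    = refl
  mul-zeroʳ (a ∷ p) (suc n) = mul-zeroʳ p n

  -- `mul` recurses on its left factor. This is the mirror recursion on the right factor, and
  -- commutativity follows by matching the two.
  mul-∷ʳ : ∀ p b q n → coeff (mul p (b ∷ q)) n ≈ b * coeff p n + coeff (0# ∷ mul p q) n
  mul-∷ʳ []      b q zero    = sym (trans (+-identityʳ _) (zeroʳ b))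
  mul-∷ʳ []      b q (suc n) = sym (trans (+-identityʳ _) (zeroʳ b))
  mul-∷ʳ (a ∷ p) b q zero    = +-congʳ (*-comm a b)
  mul-∷ʳ (a ∷ p) b q (suc n) = begin
    coeff (add (map (a *_) q) (mul p (b ∷ q))) n
      ≈⟨ coeff-add (map (a *_) q) _ n ⟩
    coeff (map (a *_) q) n + coeff (mul p (b ∷ q)) n
      ≈⟨ +-congˡ (mul-∷ʳ p b q n) ⟩
    coeff (map (a *_) q) n + (b * coeff p n + coeff (0# ∷ mul p q) n)
      ≈⟨ x+yz≈y+xz _ _ _ ⟩
    b * coeff p n + (coeff (map (a *_) q) n + coeff (0# ∷ mul p q) n)
      ≈⟨ +-congˡ (coeff-add (map (a *_) q) _ n) ⟨
    b * coeff p n + coeff (mul (a ∷ p) q) n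
      ∎

  mul-comm : ∀ p q → mul p q ≋ mul q p
  mul-comm []      q n = sym (mul-zeroʳ q n)
  mul-comm (a ∷ p) q n = begin
    coeff (mul (a ∷ p) q) n                    ≈⟨ mul-∷ˡ a p q n ⟩
    a * coeff q n + coeff (0# ∷ mul p q) n     ≈⟨ +-congˡ (shift-cong _ _ (mul-comm p q) n) ⟩
    a * coeff q n + coeff (0# ∷ mul q p) n     ≈⟨ mul-∷ʳ q a p n ⟨
    coeff (mul q (a ∷ p)) n                    ∎

  mul-congˡ : ∀ p q q′ → q ≋ q′ → mul p q ≋ mul p q′
  mul-congˡ []      q q′ q≋q′ n = refl
  mul-congˡ (a ∷ p) q q′ q≋q′ n = begin
    coeff (mul (a ∷ p) q) n                    ≈⟨ mul-∷ˡ a p q n ⟩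
    a * coeff q n + coeff (0# ∷ mul p q) n     ≈⟨ +-cong (*-congˡ (q≋q′ n)) (shift-cong _ _ (mul-congˡ p q q′ q≋q′) n) ⟩
    a * coeff q′ n + coeff (0# ∷ mul p q′) n   ≈⟨ mul-∷ˡ a p q′ n ⟨
    coeff (mul (a ∷ p) q′) n                   ∎

  -- Equal polynomials may be lists of different lengths, so `p` and `p′` cannot be traversed
  -- together; commutativity moves the change to the factor that `mul` does not recurse on.
  mul-congʳ : ∀ p p′ q → p ≋ p′ → mul p q ≋ mul p′ q
  mul-congʳ p p′ q p≋p′ n = begin
    coeff (mul p q) n    ≈⟨ mul-comm p q n ⟩
    coeff (mul q p) n    ≈⟨ mul-congˡ q p p′ p≋p′ n ⟩
    coeff (mul q p′) n   ≈⟨ mul-comm q p′ n ⟩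
    coeff (mul p′ q) n   ∎

  mul-distribˡ : ∀ p q r → mul p (add q r) ≋ add (mul p q) (mul p r)
  mul-distribˡ []      q r n = refl
  mul-distribˡ (a ∷ p) q r n = begin
    coeff (mul (a ∷ p) (add q r)) n
      ≈⟨ mul-∷ˡ a p (add q r) n ⟩
    a * coeff (add q r) n + coeff (0# ∷ mul p (add q r)) n
      ≈⟨ +-cong (trans (*-congˡ (coeff-add q r n)) (distribˡ a _ _))
                (trans (shift-cong _ _ (mul-distribˡ p q r) n) (shift-add (mul p q) _ n)) ⟩
    (a * coeff q n + a * coeff r n) + (coeff (0# ∷ mul p q) n + coeff (0# ∷ mul p r) n)
      ≈⟨ +-interchange _ _ _ _ ⟩
    (a * coeff q n + coeff (0# ∷ mul p q) n) + (a * coeff r n + coeff (0# ∷ mul p r) n)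
      ≈⟨ +-cong (mul-∷ˡ a p q n) (mul-∷ˡ a p r n) ⟨
    coeff (mul (a ∷ p) q) n + coeff (mul (a ∷ p) r) n
      ≈⟨ coeff-add (mul (a ∷ p) q) _ n ⟨
    coeff (add (mul (a ∷ p) q) (mul (a ∷ p) r)) n
      ∎

  mul-distribʳ : ∀ p q r → mul (add q r) p ≋ add (mul q p) (mul r p)
  mul-distribʳ p q r n = begin
    coeff (mul (add q r) p) n              ≈⟨ mul-comm (add q r) p n ⟩
    coeff (mul p (add q r)) n              ≈⟨ mul-distribˡ p q r n ⟩
    coeff (add (mul p q) (mul p r)) n      ≈⟨ coeff-add (mul p q) _ n ⟩
    coeff (mul p q) n + coeff (mul p r) n  ≈⟨ +-cong (mul-comm p q n) (mul-comm p r n) ⟩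
    coeff (mul q p) n + coeff (mul r p) n  ≈⟨ coeff-add (mul q p) _ n ⟨
    coeff (add (mul q p) (mul r p)) n      ∎

  mul-shiftˡ : ∀ p q → mul (0# ∷ p) q ≋ (0# ∷ mul p q)
  mul-shiftˡ p q n = trans (mul-∷ˡ 0# p q n) (trans (+-congʳ (zeroˡ _)) (+-identityˡ _))

  mul-scaleˡ : ∀ a p q → mul (map (a *_) p) q ≋ map (a *_) (mul p q)
  mul-scaleˡ a []      q n = refl
  mul-scaleˡ a (b ∷ p) q n = begin
    coeff (mul (a * b ∷ map (a *_) p) q) n
      ≈⟨ mul-∷ˡ (a * b) (map (a *_) p) q n ⟩
    a * b * coeff q n + coeff (0# ∷ mul (map (a *_) p) q) n
      ≈⟨ +-cong (*-assoc a b _)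
                (trans (shift-cong _ _ (mul-scaleˡ a p q) n) (shift-scale a (mul p q) n)) ⟩
    a * (b * coeff q n) + a * coeff (0# ∷ mul p q) n
      ≈⟨ distribˡ a _ _ ⟨
    a * (b * coeff q n + coeff (0# ∷ mul p q) n)
      ≈⟨ *-congˡ (mul-∷ˡ b p q n) ⟨
    a * coeff (mul (b ∷ p) q) n
      ≈⟨ coeff-scale a (mul (b ∷ p) q) n ⟨
    coeff (map (a *_) (mul (b ∷ p) q)) n
      ∎

  mul-assoc : ∀ p q r → mul (mul p q) r ≋ mul p (mul q r)
  mul-assoc []      q r n = refl
  mul-assoc (a ∷ p) q r n = begin
    coeff (mul (add (map (a *_) q) (0# ∷ mul p q)) r) n
      ≈⟨ mul-distribʳ r (map (a *_) q) (0# ∷ mul p q) n ⟩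
    coeff (add (mul (map (a *_) q) r) (mul (0# ∷ mul p q) r)) n
      ≈⟨ coeff-add (mul (map (a *_) q) r) _ n ⟩
    coeff (mul (map (a *_) q) r) n + coeff (mul (0# ∷ mul p q) r) n
      ≈⟨ +-cong (trans (mul-scaleˡ a q r n) (coeff-scale a (mul q r) n))
                (trans (mul-shiftˡ (mul p q) r n) (shift-cong _ _ (mul-assoc p q r) n)) ⟩
    a * coeff (mul q r) n + coeff (0# ∷ mul p (mul q r)) n
      ≈⟨ mul-∷ˡ a p (mul q r) n ⟨
    coeff (mul (a ∷ p) (mul q r)) n
      ∎

  mul-const : ∀ a p n → coeff (mul (const a) p) n ≈ a * coeff p n
  mul-const a p n = trans (mul-∷ˡ a [] p n) (trans (+-congˡ (shift-0 n)) (+-identityʳ _))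
    where
    shift-0 : ∀ n → coeff (0# ∷ []) n ≈ 0#
    shift-0 zero    = refl
    shift-0 (suc n) = refl

  mul-identityˡ : ∀ p → mul (const 1#) p ≋ p
  mul-identityˡ p n = trans (mul-const 1# p n) (*-identityˡ _)

  polynomialIsCommutativeRing : IsCommutativeRing _≋_ add mul (map (-_)) [] (const 1#)
  polynomialIsCommutativeRing = record
    { isRing = record
      { +-isAbelianGroup = record
        { isGroup = record
          { isMonoid = record
            { isSemigroup = record
              { isMagma = record
                { isEquivalence = record
                  { refl  = λ n → refl
                  ; sym   = λ p≋q n → sym (p≋q n)
                  ; trans = λ p≋q q≋r n → trans (p≋q n) (q≋r n)
                  }
                ; ∙-cong = λ {p} {p′} {q} {q′} p≋p′ q≋q′ n → begin
                    coeff (add p q) n        ≈⟨ coeff-add p q n ⟩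
                    coeff p n + coeff q n    ≈⟨ +-cong (p≋p′ n) (q≋q′ n) ⟩
                    coeff p′ n + coeff q′ n  ≈⟨ coeff-add p′ q′ n ⟨
                    coeff (add p′ q′) n      ∎
                }
              ; assoc = λ p q r n → begin
                  coeff (add (add p q) r) n              ≈⟨ coeff-add (add p q) r n ⟩
                  coeff (add p q) n + coeff r n          ≈⟨ +-congʳ (coeff-add p q n) ⟩
                  coeff p n + coeff q n + coeff r n      ≈⟨ +-assoc _ _ _ ⟩
                  coeff p n + (coeff q n + coeff r n)    ≈⟨ +-congˡ (coeff-add q r n) ⟨
                  coeff p n + coeff (add q r) n          ≈⟨ coeff-add p (add q r) n ⟨
                  coeff (add p (add q r)) n              ∎
              }
            ; identity = (λ p n → refl)
                       , (λ p n → trans (coeff-add p [] n) (+-identityʳ _))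
            }
          ; inverse = (λ p n → trans (coeff-add (map (-_) p) p n)
                                     (trans (+-congʳ (coeff-neg p n)) (-‿inverseˡ _)))
                    , (λ p n → trans (coeff-add p (map (-_) p) n)
                                     (trans (+-congˡ (coeff-neg p n)) (-‿inverseʳ _)))
          ; ⁻¹-cong = λ {p} {q} p≋q n →
              trans (coeff-neg p n) (trans (-‿cong (p≋q n)) (sym (coeff-neg q n)))
          }
        ; comm = λ p q n →
            trans (coeff-add p q n) (trans (+-comm _ _) (sym (coeff-add q p n)))
        }
      ; *-cong = λ {p} {p′} {q} {q′} p≋p′ q≋q′ n →
          trans (mul-congʳ p p′ q p≋p′ n) (mul-congˡ p′ q q′ q≋q′ n)
      ; *-assoc = mul-assoc
      ; *-identity = mul-identityˡ
                   , (λ p n → trans (mul-comm p (const 1#) n) (mul-identityˡ p n))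
      ; distrib = mul-distribˡ , mul-distribʳ
      }
    ; *-comm = mul-comm
    }

  R[X] : CommutativeRing c ℓ
  R[X] = record { isCommutativeRing = polynomialIsCommutativeRing }

  const-isRingHomomorphism : IsRingHomomorphism rawRing polynomialRing const
  const-isRingHomomorphism = record
    { isSemiringHomomorphism = record
      { isNearSemiringHomomorphism = record
        { +-isMonoidHomomorphism = record
          { isMagmaHomomorphism = record
            { isRelHomomorphism = record
              { cong = λ { a≈b zero → a≈b ; a≈b (suc n) → refl } }
            ; homo = λ a b n → refl
            }
          ; ε-homo = λ { zero → refl ; (suc n) → refl }
          }
        ; *-homo = λ { a b zero → sym (+-identityʳ _) ; a b (suc n) → refl }
        }
      ; 1#-homo = λ n → refl
      }
    ; -‿homo = λ a n → refl
    }

  -- The formal derivative and coefficientwise derivations.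

  ×-zeroʳ : ∀ n → n × 0# ≈ 0#
  ×-zeroʳ zero    = refl
  ×-zeroʳ (suc n) = trans (+-identityˡ _) (×-zeroʳ n)

  -- The helper of derivative is local to it and cannot be named, so weighted is
  -- solved by unification in derivative-∷.
  mutual
    weighted : Carrier → List Carrier → ℕ → List Carrier → List Carrier
    weighted = _

    derivative-∷ : ∀ a b p → derivative (a ∷ b ∷ p) ≡ (1 × b) ∷ weighted a (b ∷ p) 2 p
    -- The local helper is lifted over the variables of its clause, which gives `weighted` its first
    -- two arguments. Abstracting `b ∷ p` and `2` leaves the unknown applied to distinct variables,
    -- where unification has a unique solution.
    derivative-∷ a b p with b ∷ p | 2
    ... | _ | _ = ≡.refl

  coeff-weighted : ∀ a p k q n → coeff (weighted a p k q) n ≈ (k ℕ.+ n) × coeff q n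
  coeff-weighted a p k []      n       = sym (×-zeroʳ (k ℕ.+ n))
  coeff-weighted a p k (b ∷ q) zero    = ×-congˡ (≡.sym (ℕ.+-identityʳ k))
  coeff-weighted a p k (b ∷ q) (suc n) =
    trans (coeff-weighted a p (suc k) q n) (×-congˡ (≡.sym (ℕ.+-suc k n)))

  coeff-derivative : ∀ p n → coeff (derivative p) n ≈ suc n × coeff p (suc n)
  coeff-derivative []          n       = sym (×-zeroʳ (suc n))
  coeff-derivative (a ∷ [])    n       = sym (×-zeroʳ (suc n))
  coeff-derivative (a ∷ b ∷ p) zero    = refl
  coeff-derivative (a ∷ b ∷ p) (suc n) = coeff-weighted a (b ∷ p) 2 p n

  -- The product rule for `a + X p`. It is the one place where the weights are split as
  -- `suc n = 1 + n`, and it drives the induction for general products.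
  derivative-∷≋ : ∀ a p → derivative (a ∷ p) ≋ add p (0# ∷ derivative p)
  derivative-∷≋ a p n = begin
    coeff (derivative (a ∷ p)) n              ≈⟨ coeff-derivative (a ∷ p) n ⟩
    coeff p n + n × coeff p n                 ≈⟨ +-congˡ (step n) ⟩
    coeff p n + coeff (0# ∷ derivative p) n   ≈⟨ coeff-add p _ n ⟨
    coeff (add p (0# ∷ derivative p)) n       ∎
    where
    step : ∀ n → n × coeff p n ≈ coeff (0# ∷ derivative p) n
    step zero    = refl
    step (suc n) = sym (coeff-derivative p n)

  derivative-cong : ∀ p q → p ≋ q → derivative p ≋ derivative q
  derivative-cong p q p≋q n = begin
    coeff (derivative p) n       ≈⟨ coeff-derivative p n ⟩
    suc n × coeff p (suc n)      ≈⟨ ×-congʳ (suc n) (p≋q (suc n)) ⟩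
    suc n × coeff q (suc n)      ≈⟨ coeff-derivative q n ⟨
    coeff (derivative q) n       ∎

  derivative-add : ∀ p q → derivative (add p q) ≋ add (derivative p) (derivative q)
  derivative-add p q n = begin
    coeff (derivative (add p q)) n
      ≈⟨ coeff-derivative (add p q) n ⟩
    suc n × coeff (add p q) (suc n)
      ≈⟨ ×-congʳ (suc n) (coeff-add p q (suc n)) ⟩
    suc n × (coeff p (suc n) + coeff q (suc n))
      ≈⟨ ×-distrib-+ _ _ (suc n) ⟩
    suc n × coeff p (suc n) + suc n × coeff q (suc n)
      ≈⟨ +-cong (coeff-derivative p n) (coeff-derivative q n) ⟨
    coeff (derivative p) n + coeff (derivative q) n
      ≈⟨ coeff-add (derivative p) _ n ⟨
    coeff (add (derivative p) (derivative q)) n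
      ∎

  derivative-scale : ∀ a p → derivative (map (a *_) p) ≋ map (a *_) (derivative p)
  derivative-scale a p n = begin
    coeff (derivative (map (a *_) p)) n       ≈⟨ coeff-derivative (map (a *_) p) n ⟩
    suc n × coeff (map (a *_) p) (suc n)      ≈⟨ ×-congʳ (suc n) (coeff-scale a p (suc n)) ⟩
    suc n × (a * coeff p (suc n))             ≈⟨ ×-comm-* (suc n) a _ ⟨
    a * (suc n × coeff p (suc n))             ≈⟨ *-congˡ (coeff-derivative p n) ⟨
    a * coeff (derivative p) n                ≈⟨ coeff-scale a (derivative p) n ⟨
    coeff (map (a *_) (derivative p)) n       ∎

  -- The left factor is `a + X p`. Differentiating `X` leaves an extra `p q` in `shifted`, which
  -- `unfolded` absorbs into the derivative of the left factor.
  derivative-mul : ∀ p q → derivative (mul p q) ≋ add (mul (derivative p) q) (mul p (derivative q))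
  derivative-mul []      q n = refl
  derivative-mul (a ∷ p) q n = begin
    coeff (derivative (add (map (a *_) q) (0# ∷ mul p q))) n
      ≈⟨ derivative-add (map (a *_) q) (0# ∷ mul p q) n ⟩
    coeff (add (derivative (map (a *_) q)) (derivative (0# ∷ mul p q))) n
      ≈⟨ coeff-add (derivative (map (a *_) q)) _ n ⟩
    coeff (derivative (map (a *_) q)) n + coeff (derivative (0# ∷ mul p q)) n
      ≈⟨ +-cong (trans (derivative-scale a q n) (coeff-scale a q′ n)) shifted ⟩
    a * coeff q′ n
      + (coeff (mul p q) n + (coeff (0# ∷ mul p′ q) n + coeff (0# ∷ mul p q′) n))
      ≈⟨ trans (+-congˡ (sym (+-assoc _ _ _))) (x+yz≈y+xz _ _ _) ⟩
    (coeff (mul p q) n + coeff (0# ∷ mul p′ q) n)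
      + (a * coeff q′ n + coeff (0# ∷ mul p q′) n)
      ≈⟨ +-cong unfolded (sym (mul-∷ˡ a p q′ n)) ⟩
    coeff (mul (derivative (a ∷ p)) q) n + coeff (mul (a ∷ p) q′) n
      ≈⟨ coeff-add (mul (derivative (a ∷ p)) q) _ n ⟨
    coeff (add (mul (derivative (a ∷ p)) q) (mul (a ∷ p) q′)) n
      ∎
    where
    p′ = derivative p
    q′ = derivative q

    shifted : coeff (derivative (0# ∷ mul p q)) n ≈
      coeff (mul p q) n + (coeff (0# ∷ mul p′ q) n + coeff (0# ∷ mul p q′) n)
    shifted = begin
      coeff (derivative (0# ∷ mul p q)) n
        ≈⟨ derivative-∷≋ 0# (mul p q) n ⟩
      coeff (add (mul p q) (0# ∷ derivative (mul p q))) n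
        ≈⟨ coeff-add (mul p q) _ n ⟩
      coeff (mul p q) n + coeff (0# ∷ derivative (mul p q)) n
        ≈⟨ +-congˡ (trans (shift-cong _ _ (derivative-mul p q) n) (shift-add (mul p′ q) _ n)) ⟩
      coeff (mul p q) n + (coeff (0# ∷ mul p′ q) n + coeff (0# ∷ mul p q′) n)
        ∎

    unfolded : coeff (mul p q) n + coeff (0# ∷ mul p′ q) n ≈ coeff (mul (derivative (a ∷ p)) q) n
    unfolded = begin
      coeff (mul p q) n + coeff (0# ∷ mul p′ q) n       ≈⟨ +-congˡ (mul-shiftˡ p′ q n) ⟨
      coeff (mul p q) n + coeff (mul (0# ∷ p′) q) n     ≈⟨ coeff-add (mul p q) _ n ⟨
      coeff (add (mul p q) (mul (0# ∷ p′) q)) n         ≈⟨ mul-distribʳ q p (0# ∷ p′) n ⟨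
      coeff (mul (add p (0# ∷ p′)) q) n
        ≈⟨ mul-congʳ (derivative (a ∷ p)) (add p (0# ∷ p′)) q (derivative-∷≋ a p) n ⟨
      coeff (mul (derivative (a ∷ p)) q) n              ∎

  derivative-isDerivation : IsDerivation R[X] derivative
  derivative-isDerivation = record
    { D-cong  = λ {p} {q} → derivative-cong p q
    ; D-+     = derivative-add
    ; leibniz = derivative-mul
    }

  module _ {D : Carrier → Carrier} (isDerivation : IsDerivation R D) where
    open IsDerivation isDerivation

    coeff-map-D : ∀ p n → coeff (map D p) n ≈ D (coeff p n)
    coeff-map-D = coeff-map D (sym D-0#)

    -- The Leibniz rule of `D` applies inside each coefficient. Unlike for `derivative`, the
    -- indeterminate is killed, so shifting produces no extra term.
    map-D-mul : ∀ p q → map D (mul p q) ≋ add (mul (map D p) q) (mul p (map D q))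
    map-D-mul []      q n = refl
    map-D-mul (a ∷ p) q n = begin
      coeff (map D (mul (a ∷ p) q)) n
        ≈⟨ coeff-map-D (mul (a ∷ p) q) n ⟩
      D (coeff (mul (a ∷ p) q) n)
        ≈⟨ D-cong (mul-∷ˡ a p q n) ⟩
      D (a * coeff q n + coeff (0# ∷ mul p q) n)
        ≈⟨ D-+ _ _ ⟩
      D (a * coeff q n) + D (coeff (0# ∷ mul p q) n)
        ≈⟨ +-cong (trans (leibniz a _) (+-congˡ (*-congˡ (sym (coeff-map-D q n))))) (shifted n) ⟩
      (D a * coeff q n + a * coeff (map D q) n)
        + (coeff (0# ∷ mul (map D p) q) n + coeff (0# ∷ mul p (map D q)) n)
        ≈⟨ +-interchange _ _ _ _ ⟩
      (D a * coeff q n + coeff (0# ∷ mul (map D p) q) n)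
        + (a * coeff (map D q) n + coeff (0# ∷ mul p (map D q)) n)
        ≈⟨ +-cong (mul-∷ˡ (D a) (map D p) q n) (mul-∷ˡ a p (map D q) n) ⟨
      coeff (mul (map D (a ∷ p)) q) n + coeff (mul (a ∷ p) (map D q)) n
        ≈⟨ coeff-add (mul (map D (a ∷ p)) q) _ n ⟨
      coeff (add (mul (map D (a ∷ p)) q) (mul (a ∷ p) (map D q))) n
        ∎
      where
      shifted : ∀ n → D (coeff (0# ∷ mul p q) n) ≈
        coeff (0# ∷ mul (map D p) q) n + coeff (0# ∷ mul p (map D q)) n
      shifted zero    = trans D-0# (sym (+-identityˡ 0#))
      shifted (suc n) = begin
        D (coeff (mul p q) n)                                     ≈⟨ coeff-map-D (mul p q) n ⟨
        coeff (map D (mul p q)) n                                 ≈⟨ map-D-mul p q n ⟩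
        coeff (add (mul (map D p) q) (mul p (map D q))) n         ≈⟨ coeff-add (mul (map D p) q) _ n ⟩
        coeff (mul (map D p) q) n + coeff (mul p (map D q)) n     ∎

    -- Applied to the derivative of the inner ring, this makes `∂x` a derivation of `(K[x])[y]`.
    map-isDerivation : IsDerivation R[X] (map D)
    map-isDerivation = record
      { D-cong = λ {p} {q} p≋q n →
          trans (coeff-map-D p n) (trans (D-cong (p≋q n)) (sym (coeff-map-D q n)))
      ; D-+ = λ p q n → begin
          coeff (map D (add p q)) n                      ≈⟨ coeff-map-D (add p q) n ⟩
          D (coeff (add p q) n)                          ≈⟨ D-cong (coeff-add p q n) ⟩
          D (coeff p n + coeff q n)                      ≈⟨ D-+ _ _ ⟩
          D (coeff p n) + D (coeff q n)                  ≈⟨ +-cong (coeff-map-D p n) (coeff-map-D q n) ⟨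
          coeff (map D p) n + coeff (map D q) n          ≈⟨ coeff-add (map D p) _ n ⟨
          coeff (add (map D p) (map D q)) n              ∎
      ; leibniz = map-D-mul
      }

-- Ring terms, their values and their formal derivatives.

infix  8 ⊝_
infixl 7 _⊗_
infixl 6 _⊕_

data Term (n : ℕ) : Set where
  var     : Fin n → Term n
  _⊕_ _⊗_ : Term n → Term n → Term n
  ⊝_      : Term n → Term n
  𝟘 𝟙     : Term n

-- Syntax as a raw ring: the matrix and form constructions run on it and return terms, whose values
-- compute to the same constructions over the target ring.
termRing : ℕ → RawRing 0ℓ 0ℓ
termRing n = record
  { Carrier = Term n ; _≈_ = _≡_ ; _+_ = _⊕_ ; _*_ = _⊗_ ; -_ = ⊝_ ; 0# = 𝟘 ; 1# = 𝟙 }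

eval : ∀ {c ℓ n} (R : RawRing c ℓ) → (Fin n → RawRing.Carrier R) → Term n → RawRing.Carrier R
eval R ρ = go
  where
  open RawRing R
  go : Term _ → Carrier
  go (var i) = ρ i
  go (t ⊕ s) = go t + go s
  go (t ⊗ s) = go t * go s
  go (⊝ t)   = - go t
  go 𝟘       = 0#
  go 𝟙       = 1#

∂ : ∀ {n} → (Fin n → Term n) → Term n → Term n
∂ δ (var i) = δ i
∂ δ (t ⊕ s) = ∂ δ t ⊕ ∂ δ s
∂ δ (t ⊗ s) = ∂ δ t ⊗ s ⊕ t ⊗ ∂ δ s
∂ δ (⊝ t)   = ⊝ ∂ δ t
∂ δ 𝟘       = 𝟘
∂ δ 𝟙       = 𝟘

-- Deciding identities between terms by integer normal forms.

module IntegerCoefficients {c ℓ} (R : CommutativeRing c ℓ) where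
  open CommutativeRing R
  open import Algebra.Properties.Ring ring
    using (-0#≈0#; -‿distribˡ-*; -‿distribʳ-*; -‿involutive)
  open import Algebra.Properties.AbelianGroup +-abelianGroup using (⁻¹-∙-comm)
  open import Algebra.Properties.CommutativeSemigroup +-commutativeSemigroup using (interchange)
  open import Algebra.Properties.Semiring.Mult.TCOptimised semiring
    using (_×_; 1+×; ×-homo-+; ×1-homo-*)
  open import Relation.Binary.Reasoning.Setoid setoid

  -- The optimised multiple makes fromℕ 1 equal to 1# by computation.
  fromℕ : ℕ → Carrier
  fromℕ n = n × 1#

  fromℤ : ℤ → Carrier
  fromℤ (+ n)    = fromℕ n
  fromℤ -[1+ n ] = - fromℕ (suc n)

  fromℤ-⊖ : ∀ m n → fromℤ (m ⊖ n) ≈ fromℕ m - fromℕ n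
  fromℤ-⊖ zero    zero    = sym (-‿inverseʳ 0#)
  fromℤ-⊖ zero    (suc n) = sym (+-identityˡ _)
  fromℤ-⊖ (suc m) zero    = sym (trans (+-congˡ -0#≈0#) (+-identityʳ _))
  fromℤ-⊖ (suc m) (suc n) = begin
    fromℤ (suc m ⊖ suc n)                      ≡⟨ ≡.cong fromℤ (ℤ.[1+m]⊖[1+n]≡m⊖n m n) ⟩
    fromℤ (m ⊖ n)                              ≈⟨ fromℤ-⊖ m n ⟩
    fromℕ m - fromℕ n                          ≈⟨ +-identityˡ _ ⟨
    0# + (fromℕ m - fromℕ n)                   ≈⟨ +-congʳ (-‿inverseʳ 1#) ⟨
    (1# - 1#) + (fromℕ m - fromℕ n)            ≈⟨ interchange _ _ _ _ ⟩
    (1# + fromℕ m) + (- 1# - fromℕ n)          ≈⟨ +-congˡ (⁻¹-∙-comm 1# _) ⟩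
    (1# + fromℕ m) - (1# + fromℕ n)            ≈⟨ +-cong (1+× m 1#) (-‿cong (1+× n 1#)) ⟨
    fromℕ (suc m) - fromℕ (suc n)              ∎

  fromℤ-+ : ∀ i j → fromℤ (i ℤ.+ j) ≈ fromℤ i + fromℤ j
  fromℤ-+ (+ m)    (+ n)    = ×-homo-+ 1# m n
  fromℤ-+ (+ m)    -[1+ n ] = fromℤ-⊖ m (suc n)
  fromℤ-+ -[1+ m ] (+ n)    = trans (fromℤ-⊖ n (suc m)) (+-comm _ _)
  fromℤ-+ -[1+ m ] -[1+ n ] = begin
    - fromℕ (suc (suc (m ℕ.+ n)))          ≡⟨ ≡.cong (λ k → - fromℕ k) (ℕ.+-suc (suc m) n) ⟨
    - fromℕ (suc m ℕ.+ suc n)              ≈⟨ -‿cong (×-homo-+ 1# (suc m) (suc n)) ⟩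
    - (fromℕ (suc m) + fromℕ (suc n))      ≈⟨ ⁻¹-∙-comm _ _ ⟨
    - fromℕ (suc m) - fromℕ (suc n)        ∎

  fromℤ-neg : ∀ i → fromℤ (ℤ.- i) ≈ - fromℤ i
  fromℤ-neg (+ zero)  = sym -0#≈0#
  fromℤ-neg (+ suc n) = refl
  fromℤ-neg -[1+ n ]  = sym (-‿involutive _)

  fromℤ-neg-* : ∀ m n → fromℤ (ℤ.- (+ (m ℕ.* n))) ≈ - (fromℕ m * fromℕ n)
  fromℤ-neg-* m n = trans (fromℤ-neg (+ (m ℕ.* n))) (-‿cong (×1-homo-* m n))

  fromℤ-* : ∀ i j → fromℤ (i ℤ.* j) ≈ fromℤ i * fromℤ j
  fromℤ-* (+ m) (+ n) = begin
    fromℤ (+ m ℤ.* + n)     ≡⟨ ≡.cong fromℤ (ℤ.pos-* m n) ⟨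
    fromℕ (m ℕ.* n)         ≈⟨ ×1-homo-* m n ⟩
    fromℕ m * fromℕ n       ∎
  fromℤ-* (+ m) -[1+ n ] = begin
    fromℤ (+ m ℤ.* -[1+ n ])         ≡⟨ ≡.cong fromℤ (ℤ.-◃n≡-n (m ℕ.* suc n)) ⟩
    fromℤ (ℤ.- (+ (m ℕ.* suc n)))    ≈⟨ fromℤ-neg-* m (suc n) ⟩
    - (fromℕ m * fromℕ (suc n))      ≈⟨ -‿distribʳ-* _ _ ⟩
    fromℕ m * - fromℕ (suc n)        ∎
  fromℤ-* -[1+ m ] (+ n) = begin
    fromℤ (-[1+ m ] ℤ.* + n)         ≡⟨ ≡.cong fromℤ (ℤ.-◃n≡-n (suc m ℕ.* n)) ⟩
    fromℤ (ℤ.- (+ (suc m ℕ.* n)))    ≈⟨ fromℤ-neg-* (suc m) n ⟩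
    - (fromℕ (suc m) * fromℕ n)      ≈⟨ -‿distribˡ-* _ _ ⟩
    - fromℕ (suc m) * fromℕ n        ∎
  fromℤ-* -[1+ m ] -[1+ n ] = begin
    fromℕ (suc m ℕ.* suc n)                  ≈⟨ ×1-homo-* (suc m) (suc n) ⟩
    fromℕ (suc m) * fromℕ (suc n)            ≈⟨ -‿involutive _ ⟨
    - - (fromℕ (suc m) * fromℕ (suc n))      ≈⟨ -‿cong (-‿distribˡ-* _ _) ⟩
    - (- fromℕ (suc m) * fromℕ (suc n))      ≈⟨ -‿distribʳ-* _ _ ⟩
    - fromℕ (suc m) * - fromℕ (suc n)        ∎

  fromℤ-morphism : ℤ.+-*-rawRing -Raw-AlmostCommutative⟶ fromCommutativeRing R
  fromℤ-morphism = record
    { ⟦_⟧    = fromℤ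
    ; +-homo = fromℤ-+
    ; *-homo = fromℤ-*
    ; -‿homo = fromℤ-neg
    ; 0-homo = refl
    ; 1-homo = refl
    }

  -- Integer coefficients have decidable equality, while equality in `R` need not be decidable.
  module Solver = Algebra.Solver.Ring ℤ.+-*-rawRing (fromCommutativeRing R) fromℤ-morphism
    (λ i j → Maybe.map (λ i≡j → reflexive (≡.cong fromℤ i≡j)) (dec⇒maybe (i ℤ.≟ j)))
  open Solver using (Polynomial; con; _:+_; _:*_; :-_; ⟦_⟧; ⟦_⟧N; normalise; correct)

  reify : ∀ {n} → Term n → Polynomial n
  reify (var i) = Solver.var i
  reify (t ⊕ s) = reify t :+ reify s
  reify (t ⊗ s) = reify t :* reify s
  reify (⊝ t)   = :- reify t
  reify 𝟘       = con (+ 0)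
  reify 𝟙       = con (+ 1)

  eval-reify : ∀ {n} (ρ : Vec Carrier n) t → ⟦ reify t ⟧ ρ ≡ eval rawRing (lookup ρ) t
  eval-reify ρ (var i) = ≡.refl
  eval-reify ρ (t ⊕ s) = ≡.cong₂ _+_ (eval-reify ρ t) (eval-reify ρ s)
  eval-reify ρ (t ⊗ s) = ≡.cong₂ _*_ (eval-reify ρ t) (eval-reify ρ s)
  eval-reify ρ (⊝ t)   = ≡.cong -_ (eval-reify ρ t)
  eval-reify ρ 𝟘       = ≡.refl
  eval-reify ρ 𝟙       = ≡.refl

  -- The premise compares normal forms that contain no elements of `R`, so for concrete terms it
  -- holds by computation.
  solve : ∀ {n} (ρ : Vec Carrier n) t s → normalise (reify t) ≡ normalise (reify s) →
          eval rawRing (lookup ρ) t ≈ eval rawRing (lookup ρ) s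
  solve ρ t s t≡s = begin
    eval rawRing (lookup ρ) t     ≡⟨ eval-reify ρ t ⟨
    ⟦ reify t ⟧ ρ                 ≈⟨ correct (reify t) ρ ⟨
    ⟦ normalise (reify t) ⟧N ρ    ≡⟨ ≡.cong (λ p → ⟦ p ⟧N ρ) t≡s ⟩
    ⟦ normalise (reify s) ⟧N ρ    ≈⟨ correct (reify s) ρ ⟩
    ⟦ reify s ⟧ ρ                 ≡⟨ eval-reify ρ s ⟩
    eval rawRing (lookup ρ) s     ∎

-- Evaluation under derivations and ring homomorphisms.

module _ {c ℓ} {n : ℕ} (R : CommutativeRing c ℓ) where
  open CommutativeRing R

  eval-cong : {ρ σ : Fin n → Carrier} → (∀ i → ρ i ≈ σ i) →
              ∀ t → eval rawRing ρ t ≈ eval rawRing σ t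
  eval-cong ρ≈σ (var i) = ρ≈σ i
  eval-cong ρ≈σ (t ⊕ s) = +-cong (eval-cong ρ≈σ t) (eval-cong ρ≈σ s)
  eval-cong ρ≈σ (t ⊗ s) = *-cong (eval-cong ρ≈σ t) (eval-cong ρ≈σ s)
  eval-cong ρ≈σ (⊝ t)   = -‿cong (eval-cong ρ≈σ t)
  eval-cong ρ≈σ 𝟘       = refl
  eval-cong ρ≈σ 𝟙       = refl

  -- A derivation is determined by its values on generators, so it acts on the value of a term as
  -- formal differentiation does.
  eval-∂ : ∀ {D} → IsDerivation R D → (ρ : Fin n → Carrier) (δ : Fin n → Term n) →
           (∀ i → D (ρ i) ≈ eval rawRing ρ (δ i)) →
           ∀ t → D (eval rawRing ρ t) ≈ eval rawRing ρ (∂ δ t)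
  eval-∂ {D} isDerivation ρ δ Dρ≈δ = go
    where
    open IsDerivation isDerivation
    go : ∀ t → D (eval rawRing ρ t) ≈ eval rawRing ρ (∂ δ t)
    go (var i) = Dρ≈δ i
    go (t ⊕ s) = trans (D-+ _ _) (+-cong (go t) (go s))
    go (t ⊗ s) = trans (leibniz _ _) (+-cong (*-congʳ (go t)) (*-congˡ (go s)))
    go (⊝ t)   = trans (D-neg _) (-‿cong (go t))
    go 𝟘       = D-0#
    go 𝟙       = D-1#

module _ {c₁ ℓ₁ c₂ ℓ₂} {n : ℕ} {R : CommutativeRing c₁ ℓ₁} {S : CommutativeRing c₂ ℓ₂}
         {φ : CommutativeRing.Carrier R → CommutativeRing.Carrier S}
         (isHom : IsRingHomomorphism (CommutativeRing.rawRing R) (CommutativeRing.rawRing S) φ) where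
  open CommutativeRing S
  open IsRingHomomorphism isHom
  private module R = CommutativeRing R

  eval-homo : (ρ : Fin n → R.Carrier) →
              ∀ t → φ (eval R.rawRing ρ t) ≈ eval rawRing (λ i → φ (ρ i)) t
  eval-homo ρ (var i) = refl
  eval-homo ρ (t ⊕ s) = trans (+-homo _ _) (+-cong (eval-homo ρ t) (eval-homo ρ s))
  eval-homo ρ (t ⊗ s) = trans (*-homo _ _) (*-cong (eval-homo ρ t) (eval-homo ρ s))
  eval-homo ρ (⊝ t)   = trans (-‿homo _) (-‿cong (eval-homo ρ t))
  eval-homo ρ 𝟘       = 0#-homo
  eval-homo ρ 𝟙       = 1#-homo

-- The pair of matrices, its forms and the quartic, over raw rings and as terms.

module QuarticPair {c ℓ} (R : RawRing c ℓ) where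
  open RawRing R
  open RawSemiringDefinitions rawSemiring using (_^_; sum)
  open Matrices R

  -- The parameter `u` is 1 in A₀ itself; keeping it separate allows its replacement by `h + h`.
  antidiagonal : (u h : Carrier) → Matrix 3 3
  antidiagonal u h =
             (0# Vector.∷ 0#  Vector.∷ h  Vector.∷ Vector.[])
    Vector.∷ (0# Vector.∷ - u Vector.∷ 0# Vector.∷ Vector.[])
    Vector.∷ (h  Vector.∷ 0#  Vector.∷ 0# Vector.∷ Vector.[])
    Vector.∷ Vector.[]

  tridiagonal : (h a₄ a₃ a₂ a₁ a₀ : Carrier) → Matrix 3 3
  tridiagonal h a₄ a₃ a₂ a₁ a₀ =
             (a₄     Vector.∷ a₃ * h Vector.∷ 0#     Vector.∷ Vector.[])
    Vector.∷ (a₃ * h Vector.∷ a₂     Vector.∷ a₁ * h Vector.∷ Vector.[])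
    Vector.∷ (0#     Vector.∷ a₁ * h Vector.∷ a₀     Vector.∷ Vector.[])
    Vector.∷ Vector.[]

  quadraticForm : ∀ {n} → Matrix n n → Vector Carrier n → Carrier
  quadraticForm M 𝐱 = sum λ i → sum λ j → 𝐱 i * M i j * 𝐱 j

  monomials : (x y : Carrier) → Vector Carrier 3
  monomials x y = x ^ 2 Vector.∷ x * y Vector.∷ y ^ 2 Vector.∷ Vector.[]

  quartic : (a₄ a₃ a₂ a₁ a₀ x y : Carrier) → Carrier
  quartic a₄ a₃ a₂ a₁ a₀ x y =
      a₄ * x ^ 4
    + a₃ * x ^ 3 * y
    + a₂ * x ^ 2 * y ^ 2
    + a₁ * x * y ^ 3
    + a₀ * y ^ 4

module QuarticTerms where
  open RawRing (termRing 8) using (_+_; _*_; -_; 1#)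
  open RawSemiringDefinitions (RawRing.rawSemiring (termRing 8)) using (_^_)
  open QuarticPair (termRing 8)
  open Matrices (termRing 8) using (Matrix; _*ᴹ_; _†)

  a₄ a₃ a₂ a₁ a₀ x y h : Term 8
  a₄ = var 0F
  a₃ = var 1F
  a₂ = var 2F
  a₁ = var 3F
  a₀ = var 4F
  x  = var 5F
  y  = var 6F
  h  = var 7F

  δx δy : Fin 8 → Term 8
  δx = lookup (𝟘 ∷ 𝟘 ∷ 𝟘 ∷ 𝟘 ∷ 𝟘 ∷ 𝟙 ∷ 𝟘 ∷ 𝟘 ∷ [])
  δy = lookup (𝟘 ∷ 𝟘 ∷ 𝟘 ∷ 𝟘 ∷ 𝟘 ∷ 𝟘 ∷ 𝟙 ∷ 𝟘 ∷ [])

  F F₄ : Term 8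
  F  = quartic a₄ a₃ a₂ a₁ a₀ x y
  F₄ = ∂ δx (∂ δx F) * ∂ δy (∂ δy F) + - (∂ δx (∂ δy F) ^ 2)

  -- A s = s · 2A₀ and B s = s · 2B_F.
  A B : Term 8 → Matrix 3 3
  A s = antidiagonal (s + s) s
  B s = tridiagonal s ((s + s) * a₄) a₃ ((s + s) * a₂) a₁ ((s + s) * a₀)

  g-B g-A : Term 8 → Term 8
  g-B s = quadraticForm (A s *ᴹ B s † *ᴹ A s) (monomials x y)
  g-A s = quadraticForm (B s *ᴹ A s † *ᴹ B s) (monomials x y)

  -- At `s = 1#` the variable `h` is gone: these are the forms of the pair (2A₀, 2B_F).
  U V : Term 8
  U = g-B 1#
  V = g-A 1#

-- The identity for two derivations of an abstract ring.

module QuarticIdentity {c₁ ℓ₁ c₂ ℓ₂} (K : CommutativeRing c₁ ℓ₁) (S : CommutativeRing c₂ ℓ₂) where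
  private module K = CommutativeRing K
  open CommutativeRing S

  -- Of `K[x,y]` only the homomorphism from `K` and the values of the derivations on constants, `x`
  -- and `y` are retained. With `S` abstract, no coefficient list can unfold in this part.
  module Instantiate
    {φ : K.Carrier → Carrier} (φ-hom : IsRingHomomorphism K.rawRing rawRing φ)
    {∂x ∂y : Carrier → Carrier} (∂x-der : IsDerivation S ∂x) (∂y-der : IsDerivation S ∂y)
    (x y : Carrier)
    (∂x-φ : ∀ a → ∂x (φ a) ≈ 0#) (∂x-x : ∂x x ≈ 1#) (∂x-y : ∂x y ≈ 0#)
    (∂y-φ : ∀ a → ∂y (φ a) ≈ 0#) (∂y-x : ∂y x ≈ 0#) (∂y-y : ∂y y ≈ 1#)
    (h : K.Carrier) (h+h≈1 : h K.+ h K.≈ K.1#)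
    (a₄ a₃ a₂ a₁ a₀ : K.Carrier)
    where

    open RawSemiringDefinitions (RawRing.rawSemiring rawRing) using (_×_; _^_)
    open IsRingHomomorphism φ-hom using (⟦⟧-cong; +-homo; 1#-homo)
    open IntegerCoefficients S using (solve)
    open import Algebra.Properties.CommutativeMonoid.Mult +-commutativeMonoid using (×-congʳ)
    open import Algebra.Properties.Monoid.Sum +-monoid using (sum-cong-≋)
    open import Algebra.Properties.Semiring.Exp semiring using (^-congˡ)
    open import Algebra.Properties.Monoid.Mult *-monoid using (×-idem)
    open import Relation.Binary.Reasoning.Setoid setoid
    open QuarticPair rawRing using (quartic; quadraticForm; monomials)
    open QuarticPair K.rawRing using (antidiagonal; tridiagonal)
    open Matrices K.rawRing using (Matrix; _*ᴹ_; _†)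
    open Matrices (termRing 7) using () renaming (_*ᴹ_ to _*ᵀ_; _† to _†ᵀ)
    private
      module T = QuarticTerms
      module Pair = QuarticPair (termRing 7)

    hessian : Carrier → Carrier
    hessian f = ∂x (∂x f) * ∂y (∂y f) + (- (∂x (∂y f) ^ 2))

    extend : ∀ {m n} → Matrix m n → Fin m → Fin n → Carrier
    extend M i j = φ (M i j)

    A₀ B-F : Matrix 3 3
    A₀  = antidiagonal K.1# h
    B-F = tridiagonal h a₄ a₃ a₂ a₁ a₀

    F : Carrier
    F = quartic (φ a₄) (φ a₃) (φ a₂) (φ a₁) (φ a₀) x y

    ρ : Vec Carrier 8
    ρ = φ a₄ ∷ φ a₃ ∷ φ a₂ ∷ φ a₁ ∷ φ a₀ ∷ x ∷ y ∷ φ h ∷ []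

    ⟪_⟫ : Term 8 → Carrier
    ⟪_⟫ = eval rawRing (lookup ρ)

    ∂x-eval : ∀ t → ∂x ⟪ t ⟫ ≈ ⟪ ∂ T.δx t ⟫
    ∂x-eval = eval-∂ S ∂x-der (lookup ρ) T.δx λ where
      0F → ∂x-φ a₄
      1F → ∂x-φ a₃
      2F → ∂x-φ a₂
      3F → ∂x-φ a₁
      4F → ∂x-φ a₀
      5F → ∂x-x
      6F → ∂x-y
      7F → ∂x-φ h

    ∂y-eval : ∀ t → ∂y ⟪ t ⟫ ≈ ⟪ ∂ T.δy t ⟫
    ∂y-eval = eval-∂ S ∂y-der (lookup ρ) T.δy λ where
      0F → ∂y-φ a₄
      1F → ∂y-φ a₃
      2F → ∂y-φ a₂
      3F → ∂y-φ a₁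
      4F → ∂y-φ a₀
      5F → ∂y-x
      6F → ∂y-y
      7F → ∂y-φ h

    hessian-eval : hessian F ≈ ⟪ T.F₄ ⟫
    hessian-eval = +-cong
      (*-cong (trans (D-cong ∂x-der (∂x-eval T.F)) (∂x-eval (∂ T.δx T.F)))
              (trans (D-cong ∂y-der (∂y-eval T.F)) (∂y-eval (∂ T.δy T.F))))
      (-‿cong (^-congˡ 2 (trans (D-cong ∂x-der (∂y-eval T.F)) (∂x-eval (∂ T.δy T.F)))))
      where
      open IsDerivation

    2φh≈1 : φ h + φ h ≈ 1#
    2φh≈1 = trans (sym (+-homo h h)) (trans (⟦⟧-cong h+h≈1) 1#-homo)

    absorb-2φh : ∀ a → a ≈ (φ h + φ h) * a
    absorb-2φh a = trans (sym (*-identityˡ a)) (*-congʳ (sym 2φh≈1))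

    -- The `K.1#` listed here is the one in the middle entry of A₀. The ones in `sign` and `det`
    -- stay the constant `𝟙`, so they are not rescaled.
    entries : Vec K.Carrier 7
    entries = K.1# ∷ h ∷ a₄ ∷ a₃ ∷ a₂ ∷ a₁ ∷ a₀ ∷ []

    -- The images of `a₃` and `a₁` get no factor `2h`, since they already occur multiplied by `h` in
    -- B_F.
    homogenised : Vec Carrier 7
    homogenised = 2h ∷ φ h ∷ (2h * φ a₄) ∷ φ a₃ ∷ (2h * φ a₂) ∷ φ a₁ ∷ (2h * φ a₀) ∷ []
      where 2h = φ h + φ h

    φ-entries : ∀ i → φ (lookup entries i) ≈ lookup homogenised i
    φ-entries = λ where
      0F → trans 1#-homo (sym 2φh≈1)
      1F → refl
      2F → absorb-2φh _
      3F → refl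
      4F → absorb-2φh _
      5F → refl
      6F → absorb-2φh _

    quadraticForm-cong : ∀ {n} {M N : Fin n → Fin n → Carrier} 𝐱 → (∀ i j → M i j ≈ N i j) →
                         quadraticForm M 𝐱 ≈ quadraticForm N 𝐱
    quadraticForm-cong 𝐱 M≈N = sum-cong-≋ λ i → sum-cong-≋ λ j → *-congʳ (*-congˡ (M≈N i j))

    homogenise : ∀ t → φ (eval K.rawRing (lookup entries) t) ≈ eval rawRing (lookup homogenised) t
    homogenise t = trans (eval-homo {R = K} {S} φ-hom (lookup entries) t) (eval-cong S φ-entries t)

    A₀ᵀ B-Fᵀ : Matrices.Matrix (termRing 7) 3 3
    A₀ᵀ  = Pair.antidiagonal (var 0F) (var 1F)
    B-Fᵀ = Pair.tridiagonal (var 1F) (var 2F) (var 3F) (var 4F) (var 5F) (var 6F)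

    -- At concrete indices, the matrix of terms computes at `entries` to the matrix over `K`, and at
    -- `homogenised` to the value of the term matrix built from `T.A T.h` and `T.B T.h`.
    g-B-eval : quadraticForm (extend (A₀ *ᴹ B-F † *ᴹ A₀)) (monomials x y) ≈ ⟪ T.g-B T.h ⟫
    g-B-eval = quadraticForm-cong (monomials x y) λ i j → homogenise ((A₀ᵀ *ᵀ B-Fᵀ †ᵀ *ᵀ A₀ᵀ) i j)

    g-A-eval : quadraticForm (extend (B-F *ᴹ A₀ † *ᴹ B-F)) (monomials x y) ≈ ⟪ T.g-A T.h ⟫
    g-A-eval = quadraticForm-cong (monomials x y) λ i j → homogenise ((B-Fᵀ *ᵀ A₀ᵀ †ᵀ *ᵀ B-Fᵀ) i j)

    module _ {n : ℕ} where
      open RawSemiringDefinitions (RawRing.rawSemiring (termRing n)) public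
        using () renaming (_×_ to _×ᵀ_; _^_ to _^ᵀ_)

    -- The factor 16 combines with the fourth power of `φ h` into a power of `φ h + φ h`. Here `u`
    -- and `v` are solver variables, so the forms are not expanded.
    16h⁴≈1 : ∀ u v → 16 × (6 × (φ h ^ 4 * u) + 3 × (φ h ^ 4 * v)) ≈ 6 × u + 3 × v
    16h⁴≈1 u v = begin
      16 × (6 × (φ h ^ 4 * u) + 3 × (φ h ^ 4 * v))
        ≈⟨ solve (φ h ∷ u ∷ v ∷ [])
             (16 ×ᵀ (6 ×ᵀ (𝐡 ^ᵀ 4 ⊗ 𝐮) ⊕ 3 ×ᵀ (𝐡 ^ᵀ 4 ⊗ 𝐯)))
             ((𝐡 ⊕ 𝐡) ^ᵀ 4 ⊗ (6 ×ᵀ 𝐮 ⊕ 3 ×ᵀ 𝐯)) ≡.refl ⟩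
      (φ h + φ h) ^ 4 * (6 × u + 3 × v)
        ≈⟨ *-congʳ (^-congˡ 4 2φh≈1) ⟩
      1# ^ 4 * (6 × u + 3 × v)
        ≈⟨ *-congʳ (×-idem (*-identityˡ 1#) 4) ⟩
      1# * (6 × u + 3 × v)
        ≈⟨ *-identityˡ _ ⟩
      6 × u + 3 × v
        ∎
      where
      𝐡 𝐮 𝐯 : Term 3
      𝐡 = var 0F
      𝐮 = var 1F
      𝐯 = var 2F

    -- The equations keep the type checker from expanding the polynomials f, u and v
    -- when this is applied to concrete polynomials.
    identity : ∀ f M N 𝐱 u v → f ≡ F → 𝐱 ≡ monomials x y →
      u ≡ quadraticForm (extend M) 𝐱 → v ≡ quadraticForm (extend N) 𝐱 →
      (∀ i j → M i j K.≈ (A₀ *ᴹ B-F † *ᴹ A₀) i j) → (∀ i j → N i j K.≈ (B-F *ᴹ A₀ † *ᴹ B-F) i j) →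
      hessian f ≈ 16 × (6 × u + 3 × v)
    identity f M N 𝐱 u v ≡.refl ≡.refl ≡.refl ≡.refl M≈ N≈ = begin
      hessian F
        ≈⟨ hessian-eval ⟩
      ⟪ T.F₄ ⟫
        -- The integral identity in the five coefficients, `x` and `y`, checked by comparing normal
        -- forms.
        ≈⟨ solve ρ T.F₄ (6 ×ᵀ T.U ⊕ 3 ×ᵀ T.V) ≡.refl ⟩
      6 × ⟪ T.U ⟫ + 3 × ⟪ T.V ⟫
        ≈⟨ 16h⁴≈1 ⟪ T.U ⟫ ⟪ T.V ⟫ ⟨
      16 × (6 × (φ h ^ 4 * ⟪ T.U ⟫) + 3 × (φ h ^ 4 * ⟪ T.V ⟫))
        ≈⟨ ×-congʳ 16 (+-cong (×-congʳ 6 M-scaled) (×-congʳ 3 N-scaled)) ⟨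
      16 × (6 × u + 3 × v)
        ∎
      where
      M-scaled : u ≈ φ h ^ 4 * ⟪ T.U ⟫
      M-scaled = trans (quadraticForm-cong 𝐱 λ i j → ⟦⟧-cong (M≈ i j))
        (trans g-B-eval (solve ρ (T.g-B T.h) (T.h ^ᵀ 4 ⊗ T.U) ≡.refl))

      N-scaled : v ≈ φ h ^ 4 * ⟪ T.V ⟫
      N-scaled = trans (quadraticForm-cong 𝐱 λ i j → ⟦⟧-cong (N≈ i j))
        (trans g-A-eval (solve ρ (T.g-A T.h) (T.h ^ᵀ 4 ⊗ T.V) ≡.refl))

-- The identity in `K[x,y]`.

module QuarticOverField {c ℓ₁ ℓ₂} (K : HeytingField c ℓ₁ ℓ₂) (2#0 : Char≠2 K)
                        (a₄ a₃ a₂ a₁ a₀ : HeytingField.Carrier K) where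

  R : CommutativeRing c ℓ₁
  R = HeytingCommutativeRing.commutativeRing (HeytingField.heytingCommutativeRing K)

  open CommutativeRing R
  open HeytingField K using (#⇒invertible)
  open import Algebra.Properties.Ring ring using (-0#≈0#)
  open import Relation.Binary.Reasoning.Setoid setoid
  private
    module Q = QuarticForms K 2#0
    module R[x] = PolynomialRing R
    module R[x][y] = PolynomialRing R[x].R[X]
  open Q using (½; Matrix; matrix₃; _*ᴹ_; _†)

  R[x,y] : CommutativeRing c ℓ₁
  R[x,y] = R[x][y].R[X]

  private module P = CommutativeRing R[x,y]

  const-isRingHomomorphism : IsRingHomomorphism rawRing P.rawRing Q.const
  const-isRingHomomorphism = Composition.isRingHomomorphism
    (λ {p} {q} {r} → P.trans {p} {q} {r})
    R[x].const-isRingHomomorphism R[x][y].const-isRingHomomorphism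

  ½+½≈1 : ½ + ½ ≈ 1#
  ½+½≈1 = begin
    ½ + ½                  ≈⟨ +-cong (*-identityʳ ½) (*-identityʳ ½) ⟨
    ½ * 1# + ½ * 1#        ≈⟨ distribˡ ½ 1# 1# ⟨
    ½ * (1# + 1#)          ≈⟨ *-congˡ (+-identityʳ _) ⟨
    ½ * (1# + 1# + 0#)     ≈⟨ *-congˡ (+-congˡ -0#≈0#) ⟨
    ½ * (1# + 1# - 0#)     ≈⟨ proj₁ (proj₂ (#⇒invertible 2#0)) ⟩
    1#                     ∎

  ∂x-const : ∀ a → Q.∂x (Q.const a) P.≈ P.0#
  ∂x-const a zero    n = refl
  ∂x-const a (suc m) n = refl

  ∂x-x : Q.∂x Q.x P.≈ P.1#
  -- The coefficient is `1 × 1#`, that is `1# + 0#` in `K`. For `∂y-y` the zero is the empty list,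
  -- and the sum computes.
  ∂x-x zero    zero    = +-identityʳ 1#
  ∂x-x zero    (suc n) = refl
  ∂x-x (suc m) n       = refl

  ∂x-y : Q.∂x Q.y P.≈ P.0#
  ∂x-y zero          n = refl
  ∂x-y (suc zero)    n = refl
  ∂x-y (suc (suc m)) n = refl

  ∂y-const : ∀ a → Q.∂y (Q.const a) P.≈ P.0#
  ∂y-const a m n = refl

  ∂y-x : Q.∂y Q.x P.≈ P.0#
  ∂y-x m n = refl

  ∂y-y : Q.∂y Q.y P.≈ P.1#
  ∂y-y zero    zero    = refl
  ∂y-y zero    (suc n) = refl
  ∂y-y (suc m) n       = refl

  private
    module Identity = QuarticIdentity.Instantiate R R[x,y] const-isRingHomomorphism
      (R[x][y].map-isDerivation R[x].derivative-isDerivation) R[x][y].derivative-isDerivation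
      Q.x Q.y ∂x-const ∂x-x ∂x-y ∂y-const ∂y-x ∂y-y ½ ½+½≈1 a₄ a₃ a₂ a₁ a₀

  -- As a record, the comparison is an instance type with `M` as its index; resolving it matches `M`
  -- against the table in `isM-B`.
  record IsM-B (M : Matrix 3 3) : Set ℓ₁ where
    field entry : ∀ i j → M i j ≈ (Identity.A₀ *ᴹ Identity.B-F † *ᴹ Identity.A₀) i j

  record IsM-A (M : Matrix 3 3) : Set ℓ₁ where
    field entry : ∀ i j → M i j ≈ (Identity.B-F *ᴹ Identity.A₀ † *ᴹ Identity.B-F) i j

  -- A matrix is a function and not definitionally the table of its entries. In a table each entry
  -- can be a separate unknown for unification.
  tabulated : Matrix 3 3 → Matrix 3 3
  tabulated M = matrix₃
    (M 0F 0F) (M 0F 1F) (M 0F 2F)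
    (M 1F 0F) (M 1F 1F) (M 1F 2F)
    (M 2F 0F) (M 2F 1F) (M 2F 2F)

  tabulated-entry : ∀ M i j → tabulated M i j ≈ M i j
  tabulated-entry M = λ where
    0F 0F → refl
    0F 1F → refl
    0F 2F → refl
    1F 0F → refl
    1F 1F → refl
    1F 2F → refl
    2F 0F → refl
    2F 1F → refl
    2F 2F → refl

  instance
    -- The index and the field spell A₀ and B_F differently; tables reduce their comparison to
    -- concrete indices, where the spellings agree by computation.
    isM-B : IsM-B (tabulated (Q.A₀ *ᴹ Q.B-F a₄ a₃ a₂ a₁ a₀ † *ᴹ Q.A₀))
    isM-B = record { entry = tabulated-entry (Identity.A₀ *ᴹ Identity.B-F † *ᴹ Identity.A₀) }

    isM-A : IsM-A (tabulated (Q.B-F a₄ a₃ a₂ a₁ a₀ *ᴹ Q.A₀ † *ᴹ Q.B-F a₄ a₃ a₂ a₁ a₀))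
    isM-A = record { entry = tabulated-entry (Identity.B-F *ᴹ Identity.A₀ † *ᴹ Identity.B-F) }

  identity : ∀ F M N 𝐱 u v → F ≡ Identity.F → 𝐱 ≡ Q.monomials →
    u ≡ Q.quadraticForm M 𝐱 → v ≡ Q.quadraticForm N 𝐱 → ⦃ IsM-B M ⦄ → ⦃ IsM-A N ⦄ →
    Q.hessian F Q.≈ 16 Q.× (6 Q.× u Q.+ 3 Q.× v)
  identity F M N 𝐱 u v F≡ 𝐱≡ u≡ v≡ ⦃ isB ⦄ ⦃ isA ⦄ =
    Identity.identity F M N 𝐱 u v F≡ 𝐱≡ u≡ v≡ (IsM-B.entry isB) (IsM-A.entry isA)

theorem1p2 : ∀ {c ℓ₁ ℓ₂} (K : HeytingField c ℓ₁ ℓ₂) (2#0 : Char≠2 K)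
    (a₄ a₃ a₂ a₁ a₀ : HeytingField.Carrier K) →
    let open QuarticForms K 2#0
        F  = quartic a₄ a₃ a₂ a₁ a₀
        BF = B-F a₄ a₃ a₂ a₁ a₀
    in hessian F ≈ 16 × (6 × g-B A₀ BF monomials + 3 × g-A A₀ BF monomials)
-- Unfolding both sides to compare the products of matrices at every place where
-- their entries occur is infeasible.  The holes are filled from the goal, and the
-- instance arguments, which are resolved last, then compare each entry once.
theorem1p2 K 2#0 a₄ a₃ a₂ a₁ a₀ =
  identity (quartic a₄ a₃ a₂ a₁ a₀) (matrix₃ _ _ _ _ _ _ _ _ _) (matrix₃ _ _ _ _ _ _ _ _ _) monomials
    _ _ ≡.refl ≡.refl ≡.refl ≡.refl
  where
  open QuarticForms K 2#0 using (quartic; matrix₃; monomials)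
  open QuarticOverField K 2#0 a₄ a₃ a₂ a₁ a₀
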